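{- Let $X$ be a finite set with $n=|X|\ge 4$ and let $r\in X$. Then there exists a split system $\mathcal S$ on $X$ that is rooted-injective relative to $r$ and satisfies $\dim(\mathcal S)=2$. Moreover, $\mathrm{ID}^r(n)=2$.
   Context: Let $X$ be a finite set with $|X|\ge 3$. A split of $X$ is an unordered bipartition $A|B=B|A$ of $X$ into two non-empty disjoint subsets (its parts) with $A\cup B=X$. It is trivial if one of its parts has size 1. A split system on $X$ is a set $\mathcal S$ of splits of $X$ that contains all trivial splits $\{x\}|X-\{x\}$, $x\in X$. For $S\in\mathcal S$ and $x\in X$, $S(x)$ denotes the part of $S$ containing $x$. The Buneman graph $\mathcal B(\mathcal S)$ has as vertices all maps $\phi:\mathcal S\to\mathcal P(X)$ such that (B1) $\phi(S)\in S$ for all $S\in\mathcal S$, and (B2) $\phi(S)\cap\phi(S')\ne\emptyset$ for all distinct $S,S'\in\mathcal S$. Two vertices $\phi,\phi'$ are adjacent if there is a unique $S\in\mathcal S$ with $\phi(S)\neq\phi'(S)$. For $x\in X$, $\phi_x$ denotes the vertex $S\mapsto S(x)$. It is known that $\mathcal B(\mathcal S)$ is a median graph, i.e. it is connected and any three vertices $u,v,w$ have a unique median (a vertex lying on shortest paths between each pair of $u,v,w$). For $Y=\{x,y,z\}\in\binom X3$, $\phi_Y$ denotes the median of $\phi_x,\phi_y,\phi_z$ in $\mathcal B(\mathcal S)$. For $r\in X$, a split system $\mathcal S$ on $X$ is rooted-injective relative to $r$ if $\phi_{Z\cup\{r\}}\ne\phi_{Z'\cup\{r\}}$ for all distinct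 $Z,Z'\in\binom{X-\{r\}}2$. Two distinct splits $A|B$ and $C|D$ of $X$ are incompatible if $A\cap C$, $A\cap D$, $B\cap C$, $B\cap D$ are all non-empty. A set of splits is incompatible if any two distinct splits in it are incompatible. The dimension $\dim(\mathcal S)$ is the dimension of the largest hypercube contained in $\mathcal B(\mathcal S)$ (and 1 if $\mathcal B(\mathcal S)$ is a tree); equivalently (known), it is the maximum size of an incompatible subset of $\mathcal S$. For $n=|X|\geq 3$ and $r\in X$, $\mathrm{ID}^r(n)=\min\{\dim(\mathcal S):\mathcal S\text{ is a split system on }X\text{ that is rooted-injective relative to }r\}$. -}

module Defs where

open import Level using (0ℓ)
open import Data.Bool using (Bool)
open import Data.Empty using (⊥-elim)
open import Data.Fin using (Fin)
open import Data.Fin.Subset using (Subset; _∈_; _∩_; _∪_; ⁅_⁆; ⊤; Nonempty; Empty)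
open import Data.Fin.Subset.Properties using (_∈?_; ∈⊤; x∈p∩q⁺; x∈p∪q⁻)
open import Data.Nat using (ℕ; zero; suc; _≤_)
open import Data.Product using (Σ; ∃; ∃!; _×_; _,_)
open import Data.Sum using (_⊎_; inj₁; inj₂)
open import Data.Vec using (Vec; lookup)
open import Function.Bundles using (Injection)
open import Function.Definitions using (Injective)
open import Relation.Binary using (Rel; Setoid; Symmetric)
open import Relation.Binary.PropositionalEquality
  using (_≡_; _≢_; _≗_; refl; sym; trans; cong; subst; setoid; _→-setoid_)
import Relation.Binary.Construct.On as On
open import Relation.Nullary using (¬_; yes; no)

-- Throughout, X is Fin n.

record Split (n : ℕ) : Set where
  field
    part₁ part₂ : Subset n
    nonempty₁   : Nonempty part₁
    nonempty₂   : Nonempty part₂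
    disjoint    : Empty (part₁ ∩ part₂)
    cover       : part₁ ∪ part₂ ≡ ⊤

open Split public

-- A|B and B|A are the same split.
_≈ₛ_ : ∀ {n} → Rel (Split n) 0ℓ
S ≈ₛ T = (part₁ S ≡ part₁ T × part₂ S ≡ part₂ T)
       ⊎ (part₁ S ≡ part₂ T × part₂ S ≡ part₁ T)

_isPartOf_ : ∀ {n} → Subset n → Split n → Set
P isPartOf S = P ≡ part₁ S ⊎ P ≡ part₂ S

-- S(x)
partContaining : ∀ {n} → Split n → Fin n → Subset n
partContaining S x with x ∈? part₁ S
... | yes _ = part₁ S
... | no  _ = part₂ S

partContaining-isPart : ∀ {n} (S : Split n) x → partContaining S x isPartOf S
partContaining-isPart S x with x ∈? part₁ S
... | yes _ = inj₁ refl
... | no  _ = inj₂ refl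

∈-partContaining : ∀ {n} (S : Split n) x → x ∈ partContaining S x
∈-partContaining S x with x ∈? part₁ S
... | yes x∈ = x∈
... | no  x∉ with x∈p∪q⁻ (part₁ S) (part₂ S) (subst (x ∈_) (sym (cover S)) ∈⊤)
...   | inj₁ x∈ = ⊥-elim (x∉ x∈)
...   | inj₂ x∈ = x∈

-- A finite set of splits, given by an enumeration without repetition.
-- A split is trivial exactly when some singleton is one of its parts.
record SplitSystem (n : ℕ) : Set where
  field
    size     : ℕ
    split    : Fin size → Split n
    distinct : Injective _≡_ _≈ₛ_ split
    trivial  : ∀ x → ∃ λ i → ⁅ x ⁆ isPartOf split i

open SplitSystem public

-- Simple graphs; the vertices form a setoid, since the vertices of the Buneman
-- graph carry proofs that must be ignored when comparing them.
record Graph : Set₁ where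
  field
    vertices   : Setoid 0ℓ 0ℓ
  open Setoid vertices public using (_≈_) renaming (Carrier to Vertex)
  field
    Adj        : Rel Vertex 0ℓ
    Adj-sym    : Symmetric Adj
    Adj-irrefl : ∀ {u} → ¬ Adj u u
    Adj-resp   : ∀ {u u′ v v′} → u ≈ u′ → v ≈ v′ → Adj u v → Adj u′ v′

module _ (G : Graph) where
  open Graph G

  data Walk : Vertex → Vertex → Set where
    nil  : ∀ {u v} → u ≈ v → Walk u v
    cons : ∀ {u v w} → Adj u v → Walk v w → Walk u w

  length : ∀ {u v} → Walk u v → ℕ
  length (nil _)    = zero
  length (cons _ p) = suc (length p)

  LiesOn : ∀ {u v} → Vertex → Walk u v → Set
  LiesOn {u} m (nil _)    = m ≈ u
  LiesOn {u} m (cons _ p) = m ≈ u ⊎ LiesOn m p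

  -- A walk of minimum length is necessarily a path.
  IsShortest : ∀ {u v} → Walk u v → Set
  IsShortest {u} {v} p = ∀ (q : Walk u v) → length p ≤ length q

  OnShortestPath : Vertex → Vertex → Vertex → Set
  OnShortestPath u v m = Σ (Walk u v) λ p → IsShortest p × LiesOn m p

  IsMedian : Vertex → Vertex → Vertex → Vertex → Set
  IsMedian u v w m = OnShortestPath u v m × OnShortestPath v w m × OnShortestPath u w m

-- H is isomorphic to a (not necessarily induced) subgraph of G.
_⊑_ : Graph → Graph → Set
H ⊑ G = Σ (Injection (Graph.vertices H) (Graph.vertices G)) λ f →
          ∀ {u v} → Graph.Adj H u v → Graph.Adj G (Injection.to f u) (Injection.to f v)

DifferOnce : ∀ {k} {A : Set} → Rel (Fin k → A) 0ℓ
DifferOnce f g = ∃! _≡_ λ i → f i ≢ g i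

module _ {k : ℕ} {A : Set} where

  differOnce-sym : Symmetric (DifferOnce {k} {A})
  differOnce-sym (i , fi≢gi , uniq) = i , (λ e → fi≢gi (sym e)) , λ ne → uniq (λ e → ne (sym e))

  differOnce-irrefl : ∀ {f : Fin k → A} → ¬ DifferOnce f f
  differOnce-irrefl (_ , ne , _) = ne refl

  differOnce-resp : ∀ {f f′ g g′ : Fin k → A} →
                    f ≗ f′ → g ≗ g′ → DifferOnce f g → DifferOnce f′ g′
  differOnce-resp f≗ g≗ (i , ne , uniq) =
    i , (λ e → ne (trans (f≗ i) (trans e (sym (g≗ i)))))
      , λ {j} ne′ → uniq (λ e → ne′ (trans (sym (f≗ j)) (trans e (g≗ j))))

hypercube : ℕ → Graph
hypercube d = record
  { vertices   = setoid (Vec Bool d)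
  ; Adj        = λ u v → DifferOnce (lookup u) (lookup v)
  ; Adj-sym    = differOnce-sym
  ; Adj-irrefl = differOnce-irrefl
  ; Adj-resp   = λ { refl refl a → a }
  }

record BunemanVertex {n} (𝒮 : SplitSystem n) : Set where
  field
    φ  : Fin (size 𝒮) → Subset n
    B1 : ∀ i → φ i isPartOf split 𝒮 i
    B2 : ∀ i j → i ≢ j → Nonempty (φ i ∩ φ j)

open BunemanVertex public

Buneman : ∀ {n} → SplitSystem n → Graph
Buneman {n} 𝒮 = record
  { vertices   = On.setoid (Fin (size 𝒮) →-setoid Subset n) (φ {𝒮 = 𝒮})
  ; Adj        = λ u v → DifferOnce (φ u) (φ v)
  ; Adj-sym    = differOnce-sym
  ; Adj-irrefl = differOnce-irrefl
  ; Adj-resp   = differOnce-resp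
  }

-- φ_x
elementVertex : ∀ {n} (𝒮 : SplitSystem n) → Fin n → BunemanVertex 𝒮
elementVertex 𝒮 x = record
  { φ  = λ i → partContaining (split 𝒮 i) x
  ; B1 = λ i → partContaining-isPart (split 𝒮 i) x
  ; B2 = λ i j _ → x , x∈p∩q⁺ (∈-partContaining (split 𝒮 i) x , ∈-partContaining (split 𝒮 j) x)
  }

-- m = φ_{x,y,z}.  Buneman graphs are median graphs, so for distinct x, y, z
-- this determines m, and such an m always exists.
IsMedianOf : ∀ {n} (𝒮 : SplitSystem n) → Fin n → Fin n → Fin n → BunemanVertex 𝒮 → Set
IsMedianOf 𝒮 x y z m =
  IsMedian (Buneman 𝒮) (elementVertex 𝒮 x) (elementVertex 𝒮 y) (elementVertex 𝒮 z) m

-- Z = {x, y} and Z′ = {x′, y′} range over the 2-subsets of X - {r}.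
RootedInjective : ∀ {n} → Fin n → SplitSystem n → Set
RootedInjective r 𝒮 =
  ∀ x y x′ y′ →
  x ≢ r → y ≢ r → x ≢ y →
  x′ ≢ r → y′ ≢ r → x′ ≢ y′ →
  ⁅ x ⁆ ∪ ⁅ y ⁆ ≢ ⁅ x′ ⁆ ∪ ⁅ y′ ⁆ →
  ∀ m m′ → IsMedianOf 𝒮 x y r m → IsMedianOf 𝒮 x′ y′ r m′ →
  ¬ Graph._≈_ (Buneman 𝒮) m m′

-- d = dim 𝒮.  For n ≥ 3 the Buneman graph has an edge, so when it is a tree
-- this gives d = 1.
HasDim : ∀ {n} → SplitSystem n → ℕ → Set
HasDim 𝒮 d = hypercube d ⊑ Buneman 𝒮 × (∀ k → hypercube k ⊑ Buneman 𝒮 → k ≤ d)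

-- k = ID^r(n)
IsID : (n : ℕ) → Fin n → ℕ → Set
IsID n r k =
    (∃ λ (𝒮 : SplitSystem n) → RootedInjective r 𝒮 × HasDim 𝒮 k)
  × (∀ (𝒮 : SplitSystem n) d → RootedInjective r 𝒮 → HasDim 𝒮 d → k ≤ d)

{-# OPTIONS --safe #-}

-- The distance in a Buneman graph is the number of splits on which two vertices differ, so φ_{x,y,z}
-- chooses in each split the part containing at least two of x, y, z. Hence 𝒮 is rooted-injective
-- relative to r iff any two distinct pairs Z, Z′ are told apart by a cluster of 𝒮 (a part A with r ∉ A)
-- containing exactly one of them.
--
-- The clusters {y ≠ r : y ≤ b} and {y ≠ r : y ≥ b} determine the maximum and the minimum of a pair. They
-- form two chains, so of three nontrivial splits two come from the same chain and are compatible; and k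
-- edges of a k-cube at one vertex flip k pairwise incompatible splits, so the dimension is at most 2.
--
-- Conversely, telling apart the three pairs of a triple {x, y, z} needs two clusters that cross, and two
-- crossing clusters yield a square in the Buneman graph.
module Submission where

open import Defs
open import Algebra.Properties.CommutativeMonoid.Sum
  using (sum; sum-remove; ∑-distrib-+; sum-cong-≗; sum-replicate-zero)
open import Data.Bool using (Bool; true; false; if_then_else_)
import Data.Bool.Properties as Bool
open import Data.Empty using (⊥-elim)
open import Data.Fin using (Fin; zero; suc; punchIn; punchOut; _≟_)
open import Data.Fin.Properties
  using (any?; all?; ¬∀⟶∃¬; punchInᵢ≢i; punchIn-injective; punchIn-punchOut; ≤-total; ≤-isDecTotalOrder)
open import Data.Fin.Subset
  using (Subset; _∈_; _∉_; _⊆_; _⊈_; _⊂_; _∩_; _∪_; ∁; ⁅_⁆; ⊤; ∣_∣; Nonempty; Empty)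
open import Data.Fin.Subset.Properties
open import Data.List as List using (List; []; _∷_; _++_; deduplicate)
open import Data.List.Membership.Propositional.Properties using (∈-lookup; ∈-deduplicate⁻; ∈-++⁻; ∈-tabulate⁻)
open import Data.List.Relation.Unary.All as All using ([]; _∷_)
open import Data.List.Relation.Unary.All.Properties using (all-filter)
open import Data.List.Relation.Unary.AllPairs using (AllPairs; []; _∷_)
import Data.List.Relation.Unary.AllPairs.Properties as AllPairs
open import Data.List.Relation.Unary.Any as Any using (Any)
import Data.List.Relation.Unary.Any.Properties as Any
open import Data.Nat using (ℕ; zero; suc; _+_; _≤_; _<_; z≤n; s≤s)
open import Data.Nat.Induction using (<-wellFounded)
open import Data.Nat.Properties
  using (≤-refl; ≤-reflexive; ≤-trans; <⇒≱; +-identityʳ; +-mono-≤; +-mono-<-≤; +-mono-≤-<; +-monoˡ-≤;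
         +-0-commutativeMonoid; module ≤-Reasoning)
open import Data.Product as Product using (Σ; ∃; ∃₂; _×_; _,_; proj₁; proj₂)
open import Data.Sum using (_⊎_; inj₁; inj₂; [_,_]′)
open import Data.Vec as Vec using (Vec; []; _∷_; lookup; _[_]≔_)
open import Data.Vec.Functional using (updateAt)
open import Data.Vec.Functional.Properties using (updateAt-updates; updateAt-minimal)
open import Data.Vec.Properties
  using (≡-dec; []≔-commutes; lookup∘update; lookup∘update′; lookup-replicate; lookup∘tabulate;
         lookup⇒[]=; []=⇒lookup)
open import Function using (_∘_; const; flip; id)
open import Function.Bundles using (Injection)
open import Induction.WellFounded using (Acc; acc)
open import Relation.Binary using (DecidableEquality; IsDecTotalOrder; Setoid)
import Relation.Binary.Construct.Flip.EqAndOrd as Flip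
open import Relation.Binary.PropositionalEquality
  using (_≡_; _≢_; _≗_; refl; sym; trans; cong; cong₂; subst; subst₂; ≢-sym)
open import Relation.Nullary using (¬_; Dec; yes; no; does; contradiction; ¬?; _×-dec_; _⊎-dec_)
open import Relation.Nullary.Decidable using (decidable-stable; dec-true; dec-false)

private
  variable
    n k : ℕ

-- Finite sums and the Hamming distance.

∑ : (Fin k → ℕ) → ℕ
∑ = sum +-0-commutativeMonoid

∑-mono-≤ : {f g : Fin k → ℕ} → (∀ i → f i ≤ g i) → ∑ f ≤ ∑ g
∑-mono-≤ {zero}  f≤g = z≤n
∑-mono-≤ {suc k} f≤g = +-mono-≤ (f≤g zero) (∑-mono-≤ (f≤g ∘ suc))

∑-mono-< : {f g : Fin k → ℕ} → (∀ i → f i ≤ g i) → ∀ {j} → f j < g j → ∑ f < ∑ g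
∑-mono-< f≤g {zero}  fj<gj = +-mono-<-≤ fj<gj (∑-mono-≤ (f≤g ∘ suc))
∑-mono-< f≤g {suc j} fj<gj = +-mono-≤-< (f≤g zero) (∑-mono-< (f≤g ∘ suc) fj<gj)

module Hamming {A : Set} (_≟ᴬ_ : DecidableEquality A) where

  δ : A → A → ℕ
  δ x y = if does (x ≟ᴬ y) then 0 else 1

  δ-≡ : ∀ {x y} → x ≡ y → δ x y ≡ 0
  δ-≡ {x} {y} x≡y = cong (if_then 0 else 1) (dec-true (x ≟ᴬ y) x≡y)

  δ-≢ : ∀ {x y} → x ≢ y → δ x y ≡ 1
  δ-≢ {x} {y} x≢y = cong (if_then 0 else 1) (dec-false (x ≟ᴬ y) x≢y)

  δ≤1 : ∀ x y → δ x y ≤ 1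
  δ≤1 x y with x ≟ᴬ y
  ... | yes _ = z≤n
  ... | no  _ = ≤-refl

  δ-triangle : ∀ x y z → δ x z ≤ δ x y + δ y z
  δ-triangle x y z with x ≟ᴬ y
  ... | yes refl = ≤-refl
  ... | no  _    = ≤-trans (δ≤1 x z) (s≤s z≤n)

  dist : (f g : Fin k → A) → ℕ
  dist f g = ∑ (λ i → δ (f i) (g i))

  dist-≗ : {f g : Fin k → A} → f ≗ g → dist f g ≡ 0
  dist-≗ {k} f≗g = trans (sum-cong-≗ +-0-commutativeMonoid (δ-≡ ∘ f≗g)) (sum-replicate-zero +-0-commutativeMonoid k)

  -- Splitting off the summand at the differing index leaves a sum of zeros, since uniqueness forces
  -- agreement at every other index.
  dist-DifferOnce : {f g : Fin k → A} → DifferOnce f g → dist f g ≤ 1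
  dist-DifferOnce {suc k} {f} {g} (i , _ , uniq) = begin
    dist f g                                        ≡⟨ sum-remove +-0-commutativeMonoid (λ j → δ (f j) (g j)) ⟩
    δ (f i) (g i) + dist (f ∘ punchIn i) (g ∘ punchIn i)
      ≤⟨ +-mono-≤ (δ≤1 (f i) (g i)) (≤-reflexive (dist-≗ agree)) ⟩
    1                                               ∎
    where
    open ≤-Reasoning
    agree : f ∘ punchIn i ≗ g ∘ punchIn i
    agree j = decidable-stable (_ ≟ᴬ _) λ ne → punchInᵢ≢i i j (sym (uniq ne))

  dist-+ : (f g h : Fin k → A) → ∑ (λ i → δ (f i) (g i) + δ (g i) (h i)) ≡ dist f g + dist g h
  dist-+ f g h = ∑-distrib-+ +-0-commutativeMonoid (λ i → δ (f i) (g i)) (λ i → δ (g i) (h i))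

  dist-triangle : (f g h : Fin k → A) → dist f h ≤ dist f g + dist g h
  dist-triangle f g h =
    ≤-trans (∑-mono-≤ (λ i → δ-triangle (f i) (g i) (h i))) (≤-reflexive (dist-+ f g h))

-- Subsets and the two parts of a split.

_≟ˢ_ : DecidableEquality (Subset n)
_≟ˢ_ = ≡-dec Bool._≟_

open module SubsetHamming {n} = Hamming (_≟ˢ_ {n})

∁-unique : {P Q : Subset n} → Empty (P ∩ Q) → P ∪ Q ≡ ⊤ → Q ≡ ∁ P
∁-unique {P = P} {Q} disj cov = ⊆-antisym
  (λ {x} x∈Q → x∉p⇒x∈∁p λ x∈P → disj (x , x∈p∩q⁺ (x∈P , x∈Q)))
  (λ {x} x∈∁P → [ (λ x∈P → contradiction x∈∁P (x∈p⇒x∉∁p x∈P)) , id ]′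
                  (x∈p∪q⁻ P Q (subst (x ∈_) (sym cov) ∈⊤)))

⊈⇒∃∉ : {P Q : Subset n} → P ⊈ Q → ∃ λ x → x ∈ P × x ∉ Q
⊈⇒∃∉ {P = P} {Q} P⊈Q with any? (λ x → (x ∈? P) ×-dec ¬? (x ∈? Q))
... | yes found = found
... | no  none  = contradiction (λ {x} x∈P → decidable-stable (x ∈? Q) λ x∉Q → none (x , x∈P , x∉Q)) P⊈Q

module _ (S : Split n) where

  part₂≡∁part₁ : part₂ S ≡ ∁ (part₁ S)
  part₂≡∁part₁ = ∁-unique (disjoint S) (cover S)

  part₁≡∁part₂ : part₁ S ≡ ∁ (part₂ S)
  part₁≡∁part₂ = ∁-unique (subst Empty (∩-comm (part₁ S) (part₂ S)) (disjoint S))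
                          (trans (∪-comm (part₂ S) (part₁ S)) (cover S))

module _ {S : Split n} where

  part-nonempty : ∀ {P} → P isPartOf S → Nonempty P
  part-nonempty (inj₁ refl) = nonempty₁ S
  part-nonempty (inj₂ refl) = nonempty₂ S

  ∁-isPart : ∀ {P} → P isPartOf S → ∁ P isPartOf S
  ∁-isPart (inj₁ refl) = inj₂ (sym (part₂≡∁part₁ S))
  ∁-isPart (inj₂ refl) = inj₁ (sym (part₁≡∁part₂ S))

  parts-≢⇒∁ : ∀ {P Q} → P isPartOf S → Q isPartOf S → P ≢ Q → Q ≡ ∁ P
  parts-≢⇒∁ (inj₁ refl) (inj₁ refl) P≢Q = contradiction refl P≢Q
  parts-≢⇒∁ (inj₁ refl) (inj₂ refl) P≢Q = part₂≡∁part₁ S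
  parts-≢⇒∁ (inj₂ refl) (inj₁ refl) P≢Q = part₁≡∁part₂ S
  parts-≢⇒∁ (inj₂ refl) (inj₂ refl) P≢Q = contradiction refl P≢Q

  -- Distinct parts are complements of each other and share no element. This is the usual way below
  -- to identify the value of a Buneman vertex at a split.
  parts-overlap⇒≡ : ∀ {P Q} → P isPartOf S → Q isPartOf S → Nonempty (P ∩ Q) → P ≡ Q
  parts-overlap⇒≡ {P} {Q} partP partQ (x , x∈P∩Q) = decidable-stable (P ≟ˢ Q) λ P≢Q →
    let x∈P , x∈Q = x∈p∩q⁻ P Q x∈P∩Q in
    x∈p⇒x∉∁p x∈P (subst (x ∈_) (parts-≢⇒∁ partP partQ P≢Q) x∈Q)

-- The other part is the complement of the shared one. With `distinct`, a part shared by two splits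
-- of a system makes their indices equal.
common-part⇒≈ : {S T : Split n} {P : Subset n} → P isPartOf S → P isPartOf T → S ≈ₛ T
common-part⇒≈ {S = S} {T} (inj₁ refl) (inj₁ e) =
  inj₁ (e , trans (part₂≡∁part₁ S) (trans (cong ∁ e) (sym (part₂≡∁part₁ T))))
common-part⇒≈ {S = S} {T} (inj₁ refl) (inj₂ e) =
  inj₂ (e , trans (part₂≡∁part₁ S) (trans (cong ∁ e) (sym (part₁≡∁part₂ T))))
common-part⇒≈ {S = S} {T} (inj₂ refl) (inj₁ e) =
  inj₂ (trans (part₁≡∁part₂ S) (trans (cong ∁ e) (sym (part₂≡∁part₁ T))) , e)
common-part⇒≈ {S = S} {T} (inj₂ refl) (inj₂ e) =
  inj₁ (trans (part₁≡∁part₂ S) (trans (cong ∁ e) (sym (part₁≡∁part₂ T))) , e)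

-- Concatenation of walks.

module Walks (G : Graph) where
  open Graph G
  private module V = Setoid vertices

  -- A walk ending in `nil` reaches its target only up to `≈`; this shift of the source is what
  -- makes concatenation possible.
  prepend-≈ : ∀ {u v w} → u ≈ v → Walk G v w → Walk G u w
  prepend-≈ u≈v (nil v≈w)  = nil (V.trans u≈v v≈w)
  prepend-≈ u≈v (cons a p) = cons (Adj-resp (V.sym u≈v) V.refl a) p

  infixr 5 _⧺_
  _⧺_ : ∀ {u v w} → Walk G u v → Walk G v w → Walk G u w
  nil u≈v  ⧺ q = prepend-≈ u≈v q
  cons a p ⧺ q = cons a (p ⧺ q)

  length-prepend-≈ : ∀ {u v w} (u≈v : u ≈ v) (p : Walk G v w) → length G (prepend-≈ u≈v p) ≡ length G p
  length-prepend-≈ u≈v (nil _)    = refl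
  length-prepend-≈ u≈v (cons _ _) = refl

  length-⧺ : ∀ {u v w} (p : Walk G u v) (q : Walk G v w) → length G (p ⧺ q) ≡ length G p + length G q
  length-⧺ (nil u≈v)  q = length-prepend-≈ u≈v q
  length-⧺ (cons a p) q = cong suc (length-⧺ p q)

  source-liesOn : ∀ {u v m} → m ≈ u → (p : Walk G u v) → LiesOn G m p
  source-liesOn m≈u (nil _)    = m≈u
  source-liesOn m≈u (cons _ _) = inj₁ m≈u

  junction-liesOn : ∀ {u m v} (p : Walk G u m) (q : Walk G m v) → LiesOn G m (p ⧺ q)
  junction-liesOn (nil u≈m)  q = source-liesOn (V.sym u≈m) (prepend-≈ u≈m q)
  junction-liesOn (cons a p) q = inj₂ (junction-liesOn p q)

-- Distances and shortest paths in the Buneman graph.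

module _ (𝒮 : SplitSystem n) where

  private
    𝓑 = Buneman 𝒮
    V = BunemanVertex 𝒮

  open Graph 𝓑 using (_≈_; Adj)
  open Walks 𝓑

  d : V → V → ℕ
  d u v = dist (φ u) (φ v)

  ≢⇒∁ : (u v : V) → ∀ {i} → φ u i ≢ φ v i → φ v i ≡ ∁ (φ u i)
  ≢⇒∁ u v {i} = parts-≢⇒∁ {S = split 𝒮 i} (B1 u i) (B1 v i)

  φ-overlap⇒≡ : (u v : V) → ∀ {i x} → x ∈ φ u i → x ∈ φ v i → φ u i ≡ φ v i
  φ-overlap⇒≡ u v {i} x∈u x∈v = parts-overlap⇒≡ {S = split 𝒮 i} (B1 u i) (B1 v i) (_ , x∈p∩q⁺ (x∈u , x∈v))

  -- The instances of B2 that have to be checked anew when only the value of `u` at `i` is replaced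
  -- by `P`.
  Settable : V → Fin (size 𝒮) → Subset n → Set
  Settable u i P = ∀ j → i ≢ j → Nonempty (P ∩ φ u j)

  module _ (u : V) {i : Fin (size 𝒮)} {P : Subset n} (partP : P isPartOf split 𝒮 i) (ok : Settable u i P) where

    setPart : V
    φ  setPart = updateAt (φ u) i (const P)
    B1 setPart j with j ≟ i
    ... | yes refl = subst (_isPartOf split 𝒮 i) (sym (updateAt-updates i (φ u))) partP
    ... | no  j≢i  = subst (_isPartOf split 𝒮 j) (sym (updateAt-minimal j i (φ u) j≢i)) (B1 u j)
    B2 setPart j l j≢l with j ≟ i | l ≟ i
    ... | yes refl | yes refl = contradiction refl j≢l
    ... | yes refl | no  l≢i  = subst₂ (λ Q R → Nonempty (Q ∩ R))
      (sym (updateAt-updates i (φ u))) (sym (updateAt-minimal l i (φ u) l≢i)) (ok l j≢l)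
    ... | no  j≢i  | yes refl = subst₂ (λ Q R → Nonempty (Q ∩ R))
      (sym (updateAt-minimal j i (φ u) j≢i)) (sym (updateAt-updates i (φ u)))
      (subst Nonempty (∩-comm P (φ u j)) (ok j (≢-sym j≢i)))
    ... | no  j≢i  | no  l≢i  = subst₂ (λ Q R → Nonempty (Q ∩ R))
      (sym (updateAt-minimal j i (φ u) j≢i)) (sym (updateAt-minimal l i (φ u) l≢i)) (B2 u j l j≢l)

    setPart-at : φ setPart i ≡ P
    setPart-at = updateAt-updates i (φ u)

    setPart-elsewhere : ∀ {j} → j ≢ i → φ setPart j ≡ φ u j
    setPart-elsewhere {j} = updateAt-minimal j i (φ u)

  -- If flipping coordinate i of u leaves the Buneman graph, some φ u j is a proper subset of φ u i,
  -- and B2 for v forces u and v to differ at j as well; so descend to an inclusion-minimal φ u i.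
  flippable : (u v : V) → ∀ i → φ u i ≢ φ v i → Acc _<_ ∣ φ u i ∣ →
              ∃ λ j → φ u j ≢ φ v j × Settable u j (∁ (φ u j))
  flippable u v i u≢v (acc rec)
    with any? (λ j → ¬? (i ≟ j) ×-dec ¬? (nonempty? (∁ (φ u i) ∩ φ u j)))
  ... | no none = i , u≢v , λ j i≢j → decidable-stable (nonempty? _) λ e → none (j , i≢j , e)
  ... | yes (j , i≢j , empty) = flippable u v j uj≢vj (rec (p⊂q⇒∣p∣<∣q∣ uj⊂ui))
    where
    uj⊆ui : φ u j ⊆ φ u i
    uj⊆ui {x} x∈uj = x∉∁p⇒x∈p λ x∈∁ui → empty (x , x∈p∩q⁺ (x∈∁ui , x∈uj))
    uj⊂ui : φ u j ⊂ φ u i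
    uj⊂ui = uj⊆ui , ⊈⇒∃∉ λ ui⊆uj → i≢j (distinct 𝒮 (common-part⇒≈ {S = split 𝒮 i} {split 𝒮 j}
      (B1 u i) (subst (_isPartOf split 𝒮 j) (⊆-antisym uj⊆ui ui⊆uj) (B1 u j))))
    uj≢vj : φ u j ≢ φ v j
    uj≢vj uj≡vj = empty (subst₂ (λ P Q → Nonempty (P ∩ Q)) (≢⇒∁ u v u≢v) (sym uj≡vj) (B2 v i j i≢j))

  -- `flippable` supplies a coordinate `j` at which `u` and `v` differ and whose flip respects B2. A
  -- split has only two parts, so the flipped value is `φ v j`; all other coordinates stay, and the
  -- distance to `v` drops.
  step : (u v : V) → ¬ u ≈ v → ∃ λ u′ → Adj u u′ × d u′ v < d u v
  step u v u≉v
    with i , u≢v       ← ¬∀⟶∃¬ _ _ (λ i → φ u i ≟ˢ φ v i) u≉v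
    with j , uj≢vj , ok ← flippable u v i u≢v (<-wellFounded _)
    = u′ , (j , uj≢u′j , λ {l} ul≢u′l → decidable-stable (j ≟ l) λ j≢l → ul≢u′l (sym (same (≢-sym j≢l))))
         , ∑-mono-< closer {j} (subst₂ _<_ (sym (δ-≡ u′j≡vj)) (sym (δ-≢ uj≢vj)) (s≤s z≤n))
    where
    u′ = setPart u (∁-isPart {S = split 𝒮 j} (B1 u j)) ok
    same : ∀ {l} → l ≢ j → φ u′ l ≡ φ u l
    same = setPart-elsewhere u (∁-isPart {S = split 𝒮 j} (B1 u j)) ok
    u′j≡vj : φ u′ j ≡ φ v j
    u′j≡vj = trans (setPart-at u (∁-isPart {S = split 𝒮 j} (B1 u j)) ok) (sym (≢⇒∁ u v uj≢vj))
    uj≢u′j : φ u j ≢ φ u′ j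
    uj≢u′j e = uj≢vj (trans e u′j≡vj)
    closer : ∀ l → δ (φ u′ l) (φ v l) ≤ δ (φ u l) (φ v l)
    closer l with l ≟ j
    ... | yes refl = ≤-trans (≤-reflexive (δ-≡ u′j≡vj)) z≤n
    ... | no  l≢j  = ≤-reflexive (cong (λ P → δ P (φ v l)) (same l≢j))

  -- Iterates `step` by well-founded recursion on the Hamming distance. Together with `d≤length` it
  -- shows that the graph distance is `d`.
  geodesic : (u v : V) → Acc _<_ (d u v) → ∃ λ (p : Walk 𝓑 u v) → length 𝓑 p ≤ d u v
  geodesic u v (acc rec) with all? (λ i → φ u i ≟ˢ φ v i)
  ... | yes u≈v = nil u≈v , z≤n
  ... | no  u≉v with step u v u≉v
  ...   | u′ , adj , d< with geodesic u′ v (rec d<)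
  ...     | p , ∣p∣≤ = cons adj p , ≤-trans (s≤s ∣p∣≤) d<

  d-adj : ∀ {u v} w → Adj u v → d u w ≤ suc (d v w)
  d-adj {u} {v} w adj = ≤-trans (dist-triangle (φ u) (φ v) (φ w))
    (+-monoˡ-≤ (d v w) (dist-DifferOnce adj))

  -- Each edge changes one coordinate and so brings the walk closer to its target by at most one.
  d≤length : ∀ {u v} (p : Walk 𝓑 u v) → d u v ≤ length 𝓑 p
  d≤length (nil u≈v)              = ≤-reflexive (dist-≗ u≈v)
  d≤length {u} {v} (cons {v = w} adj p) = ≤-trans (d-adj {u} {w} v adj) (s≤s (d≤length p))

  -- The walk is followed until it reaches `m`. Each earlier edge accounts for at most one unit of
  -- `d u m`, and the remaining walk is at least as long as `d m v`.
  d-via≤length : ∀ {u v} m (p : Walk 𝓑 u v) → LiesOn 𝓑 m p → d u m + d m v ≤ length 𝓑 p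
  d-via≤length {u} {v} m (nil u≈v) m≈u = ≤-reflexive
    (cong₂ _+_ (dist-≗ (sym ∘ m≈u)) (dist-≗ (λ i → trans (m≈u i) (u≈v i))))
  d-via≤length {u} {v} m p@(cons _ _) (inj₁ m≈u) = begin
    d u m + d m v         ≡⟨ cong (_+ d m v) (dist-≗ (sym ∘ m≈u)) ⟩
    d m v                 ≤⟨ dist-triangle (φ m) (φ u) (φ v) ⟩
    d m u + d u v         ≡⟨ cong (_+ d u v) (dist-≗ m≈u) ⟩
    d u v                 ≤⟨ d≤length p ⟩
    length 𝓑 p            ∎
    where open ≤-Reasoning
  d-via≤length {u} {v} m (cons {v = w} adj p) (inj₂ on) =
    ≤-trans (+-monoˡ-≤ (d m v) (d-adj {u} {w} m adj)) (s≤s (d-via≤length m p on))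

  -- The metric interval between `u` and `v`, written coordinatewise; the next two lemmas identify
  -- it with the set of vertices on shortest paths.
  Between : V → V → V → Set
  Between u v m = ∀ i → φ m i ≡ φ u i ⊎ φ m i ≡ φ v i

  -- Geodesics from `u` to `m` and from `m` to `v` are joined. In each coordinate at most one of the
  -- two changes occurs, so the lengths add up to at most `d u v`, which bounds every walk from
  -- below.
  between⇒onShortestPath : ∀ {u v m} → Between u v m → OnShortestPath 𝓑 u v m
  between⇒onShortestPath {u} {v} {m} btw
    with p , ∣p∣≤ ← geodesic u m (<-wellFounded _)
    with q , ∣q∣≤ ← geodesic m v (<-wellFounded _)
    = p ⧺ q , shortest , junction-liesOn p q
    where
    δ-between : ∀ i → δ (φ u i) (φ m i) + δ (φ m i) (φ v i) ≤ δ (φ u i) (φ v i)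
    δ-between i with φ m i | btw i
    ... | _ | inj₁ refl = ≤-reflexive (cong (_+ δ (φ u i) (φ v i)) (δ-≡ {x = φ u i} refl))
    ... | _ | inj₂ refl = ≤-reflexive (trans (cong (δ (φ u i) (φ v i) +_) (δ-≡ {x = φ v i} refl)) (+-identityʳ _))
    open ≤-Reasoning
    shortest : IsShortest 𝓑 (p ⧺ q)
    shortest s = begin
      length 𝓑 (p ⧺ q)            ≡⟨ length-⧺ p q ⟩
      length 𝓑 p + length 𝓑 q     ≤⟨ +-mono-≤ ∣p∣≤ ∣q∣≤ ⟩
      d u m + d m v               ≡⟨ dist-+ (φ u) (φ m) (φ v) ⟨
      ∑ (λ i → δ (φ u i) (φ m i) + δ (φ m i) (φ v i)) ≤⟨ ∑-mono-≤ δ-between ⟩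
      d u v                       ≤⟨ d≤length s ⟩
      length 𝓑 s                  ∎

  -- If `φ m i` differs from both values, then `u` and `v` agree at `i`, there being only two parts.
  -- The triangle inequality is then strict at `i`, and a walk through `m` is longer than a
  -- geodesic.
  onShortestPath⇒between : ∀ {u v m} → OnShortestPath 𝓑 u v m → Between u v m
  onShortestPath⇒between {u} {v} {m} (p , shortest , on) i
    with φ m i ≟ˢ φ u i | φ m i ≟ˢ φ v i
  ... | yes e  | _      = inj₁ e
  ... | no  _  | yes e  = inj₂ e
  ... | no  m≢u | no m≢v = contradiction long (<⇒≱ short)
    where
    ui≡vi : φ u i ≡ φ v i
    ui≡vi = trans (≢⇒∁ m u m≢u) (sym (≢⇒∁ m v m≢v))
    short : d u v < d u m + d m v
    short = subst (d u v <_) (dist-+ (φ u) (φ m) (φ v))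
      (∑-mono-< (λ j → δ-triangle (φ u j) (φ m j) (φ v j)) {i}
        (subst₂ _<_ (sym (δ-≡ ui≡vi))
          (sym (cong₂ _+_ (δ-≢ (≢-sym m≢u)) (δ-≢ m≢v))) (s≤s z≤n)))
    long : d u m + d m v ≤ d u v
    long with q , ∣q∣≤ ← geodesic u v (<-wellFounded _) =
      ≤-trans (d-via≤length m p on) (≤-trans (shortest q) ∣q∣≤)

-- Medians as coordinatewise majorities.

Majority : Fin n → Fin n → Fin n → Subset n → Set
Majority x y z P = (x ∈ P ⊎ y ∈ P) × (y ∈ P ⊎ z ∈ P) × (x ∈ P ⊎ z ∈ P)

majority-xy : {x y z : Fin n} {P : Subset n} → x ∈ P → y ∈ P → Majority x y z P
majority-xy x∈ y∈ = inj₁ x∈ , inj₁ y∈ , inj₁ x∈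

-- Applied with `z` equal to the root: a majority part that omits the root is a cluster containing
-- the whole pair.
majority-∌z : {x y z : Fin n} {P : Subset n} → Majority x y z P → z ∉ P → x ∈ P × y ∈ P
majority-∌z (_ , yz , xz) z∉ =
  [ id , flip contradiction z∉ ]′ xz , [ id , flip contradiction z∉ ]′ yz

-- Any two 2-subsets of a triple intersect. This gives B2 for the majority vertex and also the
-- uniqueness of the majority part of a split.
majorities-meet : {x y z : Fin n} {P Q : Subset n} → Majority x y z P → Majority x y z Q → Nonempty (P ∩ Q)
majorities-meet {x = x} {y} {z} {P} {Q} (xy , yz , xz) (xy′ , yz′ , xz′) = go xy yz xz
  where
  meet : ∀ {a b} → a ∈ P → b ∈ P → a ∈ Q ⊎ b ∈ Q → Nonempty (P ∩ Q)
  meet a∈ b∈ (inj₁ a∈′) = _ , x∈p∩q⁺ (a∈ , a∈′)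
  meet a∈ b∈ (inj₂ b∈′) = _ , x∈p∩q⁺ (b∈ , b∈′)
  go : x ∈ P ⊎ y ∈ P → y ∈ P ⊎ z ∈ P → x ∈ P ⊎ z ∈ P → Nonempty (P ∩ Q)
  go (inj₁ x∈) (inj₁ y∈) _         = meet x∈ y∈ xy′
  go (inj₁ x∈) (inj₂ z∈) _         = meet x∈ z∈ xz′
  go (inj₂ y∈) _         (inj₁ x∈) = meet x∈ y∈ xy′
  go (inj₂ y∈) _         (inj₂ z∈) = meet y∈ z∈ yz′

module _ (S : Split n) where

  -- If neither `y` nor `z` lies on the side of `x`, both lie on the other side.
  majorityPart : ∀ x y z → ∃ λ P → P isPartOf S × Majority x y z P
  majorityPart x y z with y ∈? Sx | z ∈? Sx
    where Sx = partContaining S x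
  ... | yes y∈ | _      = _ , partContaining-isPart S x , majority-xy (∈-partContaining S x) y∈
  ... | no _   | yes z∈ = _ , partContaining-isPart S x ,
    (inj₁ (∈-partContaining S x) , inj₂ z∈ , inj₁ (∈-partContaining S x))
  ... | no y∉  | no z∉  = _ , ∁-isPart {S = S} (partContaining-isPart S x) ,
    (inj₂ (x∉p⇒x∈∁p y∉) , inj₁ (x∉p⇒x∈∁p y∉) , inj₂ (x∉p⇒x∈∁p z∉))

module _ (𝒮 : SplitSystem n) where

  majorityVertex : Fin n → Fin n → Fin n → BunemanVertex 𝒮
  majorityVertex x y z = record
    { φ  = λ i → proj₁ (majorityPart (split 𝒮 i) x y z)
    ; B1 = λ i → proj₁ (proj₂ (majorityPart (split 𝒮 i) x y z))
    ; B2 = λ i j _ → majorities-meet (proj₂ (proj₂ (majorityPart (split 𝒮 i) x y z)))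
                                     (proj₂ (proj₂ (majorityPart (split 𝒮 j) x y z)))
    }

  module _ {x y z : Fin n} {m : BunemanVertex 𝒮} where

    -- A part containing `a` is the value of the vertex of `a` there, so each of the three
    -- disjunctions in `Majority` is one of the three betweenness conditions of a median.
    majority⇒median : (∀ i → Majority x y z (φ m i)) → IsMedianOf 𝒮 x y z m
    majority⇒median maj =
        between⇒onShortestPath 𝒮 (either x y (proj₁ ∘ maj))
      , between⇒onShortestPath 𝒮 (either y z (proj₁ ∘ proj₂ ∘ maj))
      , between⇒onShortestPath 𝒮 (either x z (proj₂ ∘ proj₂ ∘ maj))
      where
      either : ∀ a b → (∀ i → a ∈ φ m i ⊎ b ∈ φ m i) → Between 𝒮 (elementVertex 𝒮 a) (elementVertex 𝒮 b) m
      either a b h i with h i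
      ... | inj₁ a∈ = inj₁ (φ-overlap⇒≡ 𝒮 m (elementVertex 𝒮 a) a∈ (∈-partContaining (split 𝒮 i) a))
      ... | inj₂ b∈ = inj₂ (φ-overlap⇒≡ 𝒮 m (elementVertex 𝒮 b) b∈ (∈-partContaining (split 𝒮 i) b))

    median⇒majority : IsMedianOf 𝒮 x y z m → ∀ i → Majority x y z (φ m i)
    median⇒majority (xy , yz , xz) i = either x y xy , either y z yz , either x z xz
      where
      either : ∀ a b → OnShortestPath (Buneman 𝒮) (elementVertex 𝒮 a) (elementVertex 𝒮 b) m → a ∈ φ m i ⊎ b ∈ φ m i
      either a b on with onShortestPath⇒between 𝒮 on i
      ... | inj₁ e = inj₁ (subst (a ∈_) (sym e) (∈-partContaining (split 𝒮 i) a))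
      ... | inj₂ e = inj₂ (subst (b ∈_) (sym e) (∈-partContaining (split 𝒮 i) b))

  majorityVertex-isMedian : ∀ x y z → IsMedianOf 𝒮 x y z (majorityVertex x y z)
  majorityVertex-isMedian x y z = majority⇒median {m = majorityVertex x y z}
    λ i → proj₂ (proj₂ (majorityPart (split 𝒮 i) x y z))

-- Squares obtained by flipping two splits.

flipIf : Bool → Subset n → Subset n
flipIf b P = if b then ∁ P else P

flipIf-isPart : {S : Split n} {P : Subset n} → ∀ b → P isPartOf S → flipIf b P isPartOf S
flipIf-isPart         false partP = partP
flipIf-isPart {S = S} true  partP = ∁-isPart {S = S} partP

flipIf-injective : {P : Subset n} → Nonempty P → ∀ {b c} → flipIf b P ≡ flipIf c P → b ≡ c
flipIf-injective _          {false} {false} e = refl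
flipIf-injective (x , x∈P)  {false} {true}  e = contradiction (subst (x ∈_) e x∈P) (x∈p⇒x∉∁p x∈P)
flipIf-injective (x , x∈P)  {true}  {false} e = contradiction (subst (x ∈_) (sym e) x∈P) (x∈p⇒x∉∁p x∈P)
flipIf-injective _          {true}  {true}  e = refl

module _ (𝒮 : SplitSystem n) (u : BunemanVertex 𝒮) {a b : Fin (size 𝒮)} (a≢b : a ≢ b)
         (flip-a  : Settable 𝒮 u a (∁ (φ u a)))
         (flip-b  : Settable 𝒮 u b (∁ (φ u b)))
         (flip-ab : Nonempty (∁ (φ u a) ∩ ∁ (φ u b))) where

  private
    partFlipped : ∀ s i → flipIf s (φ u i) isPartOf split 𝒮 i
    partFlipped s i = flipIf-isPart {S = split 𝒮 i} s (B1 u i)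

    flipIf-settable : ∀ {i} → Settable 𝒮 u i (∁ (φ u i)) → ∀ s → Settable 𝒮 u i (flipIf s (φ u i))
    flipIf-settable {i} ok false = B2 u i
    flipIf-settable {i} ok true  = ok

    module Flipped₁ (s : Bool) where
      ok : Settable 𝒮 u a (flipIf s (φ u a))
      ok = flipIf-settable flip-a s

      vertex : BunemanVertex 𝒮
      vertex = setPart 𝒮 u (partFlipped s a) ok

      at-a : φ vertex a ≡ flipIf s (φ u a)
      at-a = setPart-at 𝒮 u (partFlipped s a) ok

      off-a : ∀ {j} → j ≢ a → φ vertex j ≡ φ u j
      off-a = setPart-elsewhere 𝒮 u (partFlipped s a) ok

    module Flipped₂ (s t : Bool) where
      open Flipped₁ s using () renaming (vertex to v; at-a to v-at-a; off-a to v-off-a)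

      -- B2 between the coordinates `b` and `a` at the four corners: `u` itself, either single flip,
      -- and the double flip, which alone uses `flip-ab`.
      meet : ∀ s t → Nonempty (flipIf t (φ u b) ∩ flipIf s (φ u a))
      meet false false = B2 u b a (≢-sym a≢b)
      meet true  false = subst Nonempty (∩-comm _ (φ u b)) (flip-a b a≢b)
      meet false true  = flip-b a (≢-sym a≢b)
      meet true  true  = subst Nonempty (∩-comm _ _) flip-ab

      ok : Settable 𝒮 v b (flipIf t (φ u b))
      ok j b≢j with j ≟ a
      ... | yes refl = subst (λ P → Nonempty (flipIf t (φ u b) ∩ P)) (sym v-at-a) (meet s t)
      ... | no  j≢a  = subst (λ P → Nonempty (flipIf t (φ u b) ∩ P)) (sym (v-off-a j≢a))
        (flipIf-settable flip-b t j b≢j)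

      vertex : BunemanVertex 𝒮
      vertex = setPart 𝒮 v (partFlipped t b) ok

      at-b : φ vertex b ≡ flipIf t (φ u b)
      at-b = setPart-at 𝒮 v (partFlipped t b) ok

      at-a : φ vertex a ≡ flipIf s (φ u a)
      at-a = trans (setPart-elsewhere 𝒮 v (partFlipped t b) ok a≢b) v-at-a

      elsewhere : ∀ {j} → j ≢ a → j ≢ b → φ vertex j ≡ φ u j
      elsewhere j≢a j≢b = trans (setPart-elsewhere 𝒮 v (partFlipped t b) ok j≢b) (v-off-a j≢a)

    open Flipped₂ using (vertex; at-a; at-b; elsewhere)

    flipped-injective : ∀ i {s s′} → flipIf s (φ u i) ≡ flipIf s′ (φ u i) → s ≡ s′
    flipped-injective i = flipIf-injective (part-nonempty {S = split 𝒮 i} (B1 u i))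

    corner : Vec Bool 2 → BunemanVertex 𝒮
    corner v = vertex (lookup v zero) (lookup v (suc zero))

    corner-injective : ∀ {v w} → (∀ i → φ (corner v) i ≡ φ (corner w) i) → v ≡ w
    corner-injective {s ∷ t ∷ []} {s′ ∷ t′ ∷ []} e = cong₂ (λ x y → x ∷ y ∷ [])
      (flipped-injective a (trans (sym (at-a s t)) (trans (e a) (at-a s′ t′))))
      (flipped-injective b (trans (sym (at-b s t)) (trans (e b) (at-b s′ t′))))

    corner-adj : ∀ {v w} → DifferOnce (lookup v) (lookup w) → DifferOnce (φ (corner v)) (φ (corner w))
    corner-adj {s ∷ t ∷ []} {s′ ∷ t′ ∷ []} (zero , s≢s′ , uniq) =
      a , (λ e → s≢s′ (flipped-injective a (trans (sym (at-a s t)) (trans e (at-a s′ t′))))) ,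
      λ {j} ne → decidable-stable (a ≟ j) λ a≢j → ne (same j a≢j)
      where
      -- A second difference would, by uniqueness, identify the two coordinates of the square.
      t≡t′ : t ≡ t′
      t≡t′ = decidable-stable (t Bool.≟ t′) λ t≢t′ → contradiction (uniq {suc zero} t≢t′) λ ()
      same : ∀ j → a ≢ j → φ (vertex s t) j ≡ φ (vertex s′ t′) j
      same j a≢j with j ≟ b
      ... | yes refl = trans (at-b s t) (trans (cong (λ x → flipIf x (φ u b)) t≡t′) (sym (at-b s′ t′)))
      ... | no j≢b   = trans (elsewhere s t (≢-sym a≢j) j≢b) (sym (elsewhere s′ t′ (≢-sym a≢j) j≢b))
    corner-adj {s ∷ t ∷ []} {s′ ∷ t′ ∷ []} (suc zero , t≢t′ , uniq) =
      b , (λ e → t≢t′ (flipped-injective b (trans (sym (at-b s t)) (trans e (at-b s′ t′))))) ,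
      λ {j} ne → decidable-stable (b ≟ j) λ b≢j → ne (same j b≢j)
      where
      s≡s′ : s ≡ s′
      s≡s′ = decidable-stable (s Bool.≟ s′) λ s≢s′ → contradiction (uniq {zero} s≢s′) λ ()
      same : ∀ j → b ≢ j → φ (vertex s t) j ≡ φ (vertex s′ t′) j
      same j b≢j with j ≟ a
      ... | yes refl = trans (at-a s t) (trans (cong (λ x → flipIf x (φ u a)) s≡s′) (sym (at-a s′ t′)))
      ... | no j≢a   = trans (elsewhere s t j≢a (≢-sym b≢j)) (sym (elsewhere s′ t′ j≢a (≢-sym b≢j)))

  -- The Boolean coordinates record whether the splits `a` and `b` are flipped. Parts are nonempty
  -- and so differ from their complements, which makes the four corners distinct.
  square⊑Buneman : hypercube 2 ⊑ Buneman 𝒮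
  square⊑Buneman = record
    { to        = corner
    ; cong      = λ { refl i → refl }
    ; injective = corner-injective
    } , λ {v} {w} → corner-adj {v} {w}

-- Crossing clusters and the lower bound on the dimension.

module _ (𝒮 : SplitSystem n) (r : Fin n) where

  IsCluster : Fin (size 𝒮) → Subset n → Set
  IsCluster i A = A isPartOf split 𝒮 i × r ∉ A

  -- The gate of φ_r in the convex set of vertices choosing A and C: keep S(r) unless it misses A or C.
  data Corner (A C P : Subset n) : Set where
    keeps  : r ∈ P → Nonempty (A ∩ P) → Nonempty (C ∩ P) → Corner A C P
    above₁ : A ⊆ P → Corner A C P
    above₂ : C ⊆ P → Corner A C P

  corner-swap : ∀ {A C P} → Corner A C P → Corner C A P
  corner-swap (keeps r∈ a c) = keeps r∈ c a
  corner-swap (above₁ A⊆)    = above₂ A⊆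
  corner-swap (above₂ C⊆)    = above₁ C⊆

  cornerPart : ∀ A C i → ∃ λ P → P isPartOf split 𝒮 i × Corner A C P
  cornerPart A C i
    with P ← partContaining (split 𝒮 i) r | r∈P ← ∈-partContaining (split 𝒮 i) r
       | partP ← partContaining-isPart (split 𝒮 i) r
    with nonempty? (A ∩ P) | nonempty? (C ∩ P)
  ... | yes A∩P | yes C∩P = P , partP , keeps r∈P A∩P C∩P
  ... | no A∩P∅ | _ = ∁ P , ∁-isPart {S = split 𝒮 i} partP ,
    above₁ λ {x} x∈A → x∉p⇒x∈∁p λ x∈P → A∩P∅ (x , x∈p∩q⁺ (x∈A , x∈P))
  ... | _ | no C∩P∅ = ∁ P , ∁-isPart {S = split 𝒮 i} partP ,
    above₂ λ {x} x∈C → x∉p⇒x∈∁p λ x∈P → C∩P∅ (x , x∈p∩q⁺ (x∈C , x∈P))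

  -- B2 for the gate. Two kept parts share `r`; a kept part meets both `A` and `C`, hence anything
  -- above either; two parts above `A` or `C` share an element of the intersection of `A` and `C`.
  corners-meet : ∀ {A C P Q} → Nonempty (A ∩ C) →
                 Corner A C P → Corner A C Q → Nonempty (P ∩ Q)
  corners-meet _ (keeps r∈P _ _) (keeps r∈Q _ _) = r , x∈p∩q⁺ (r∈P , r∈Q)
  corners-meet {A} {P = P} _ (keeps _ (x , x∈) _) (above₁ A⊆Q) =
    let x∈A , x∈P = x∈p∩q⁻ A P x∈ in x , x∈p∩q⁺ (x∈P , A⊆Q x∈A)
  corners-meet {C = C} {P} _ (keeps _ _ (x , x∈)) (above₂ C⊆Q) =
    let x∈C , x∈P = x∈p∩q⁻ C P x∈ in x , x∈p∩q⁺ (x∈P , C⊆Q x∈C)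
  corners-meet {A} {Q = Q} _ (above₁ A⊆P) (keeps _ (x , x∈) _) =
    let x∈A , x∈Q = x∈p∩q⁻ A Q x∈ in x , x∈p∩q⁺ (A⊆P x∈A , x∈Q)
  corners-meet {C = C} {Q = Q} _ (above₂ C⊆P) (keeps _ _ (x , x∈)) =
    let x∈C , x∈Q = x∈p∩q⁻ C Q x∈ in x , x∈p∩q⁺ (C⊆P x∈C , x∈Q)
  corners-meet {A} {C} (x , x∈) (above₁ A⊆P) (above₁ A⊆Q) =
    let x∈A = p∩q⊆p A C x∈ in x , x∈p∩q⁺ (A⊆P x∈A , A⊆Q x∈A)
  corners-meet {A} {C} (x , x∈) (above₂ C⊆P) (above₂ C⊆Q) =
    let x∈C = p∩q⊆q A C x∈ in x , x∈p∩q⁺ (C⊆P x∈C , C⊆Q x∈C)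
  corners-meet {A} {C} (x , x∈) (above₁ A⊆P) (above₂ C⊆Q) =
    let x∈A , x∈C = x∈p∩q⁻ A C x∈ in x , x∈p∩q⁺ (A⊆P x∈A , C⊆Q x∈C)
  corners-meet {A} {C} (x , x∈) (above₂ C⊆P) (above₁ A⊆Q) =
    let x∈A , x∈C = x∈p∩q⁻ A C x∈ in x , x∈p∩q⁺ (C⊆P x∈C , A⊆Q x∈A)

  -- In every case of `Corner` the part meets `A`, and overlapping parts of one split coincide.
  -- Hence the gate does choose `A`.
  corner-at : ∀ {i A C P p} → IsCluster i A → P isPartOf split 𝒮 i → p ∈ A → p ∈ C → Corner A C P → P ≡ A
  corner-at {i} {A} {C} {P} {p} (partA , r∉A) partP p∈A p∈C c = parts-overlap⇒≡ {S = split 𝒮 i} partP partA (meet c)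
    where
    meet : Corner A C P → Nonempty (P ∩ A)
    meet (keeps r∈P A∩P _) = subst Nonempty (∩-comm A P) A∩P
    meet (above₁ A⊆P)      = p , x∈p∩q⁺ (A⊆P p∈A , p∈A)
    meet (above₂ C⊆P)      = p , x∈p∩q⁺ (C⊆P p∈C , p∈A)

  -- The flip of `A` is witnessed by `r` if `P` is kept and by `s` if `P` lies above `C`. If `P`
  -- lies above `A`, the inclusion is proper because distinct indices carry distinct splits.
  corner-flippable : ∀ {i j A C P s} → IsCluster i A → P isPartOf split 𝒮 j → i ≢ j → s ∈ C → s ∉ A →
                     Corner A C P → Nonempty (∁ A ∩ P)
  corner-flippable (_ , r∉A) _ _ _ _ (keeps r∈P _ _) = r , x∈p∩q⁺ (x∉p⇒x∈∁p r∉A , r∈P)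
  corner-flippable _ _ _ s∈C s∉A (above₂ C⊆P) = _ , x∈p∩q⁺ (x∉p⇒x∈∁p s∉A , C⊆P s∈C)
  corner-flippable {i} {j} {A} {P = P} (partA , _) partP i≢j _ _ (above₁ A⊆P) =
    let x , x∈P , x∉A = ⊈⇒∃∉ P⊈A in x , x∈p∩q⁺ (x∉p⇒x∈∁p x∉A , x∈P)
    where
    P⊈A : P ⊈ A
    P⊈A P⊆A = i≢j (distinct 𝒮 (common-part⇒≈ {S = split 𝒮 i} {split 𝒮 j} partA
      (subst (_isPartOf split 𝒮 j) (⊆-antisym P⊆A A⊆P) partP)))

  -- The elements `p`, `q`, `s` and `r` witness the four intersections of parts. From the gate
  -- choosing `A` and `C` either split can be flipped, and both together since `r` lies outside both
  -- clusters.
  crossing⇒square : ∀ {i j A C p q s} → IsCluster i A → IsCluster j C →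
                    p ∈ A → q ∈ A → s ∉ A → p ∈ C → s ∈ C → q ∉ C → hypercube 2 ⊑ Buneman 𝒮
  crossing⇒square {i} {j} {A} {C} {p} {q} {s} clA@(partA , r∉A) clC@(partC , r∉C) p∈A q∈A s∉A p∈C s∈C q∉C =
    square⊑Buneman 𝒮 u i≢j
      (λ l i≢l → subst (λ P → Nonempty (∁ P ∩ φ u l)) (sym ui≡A)
        (corner-flippable clA (B1 u l) i≢l s∈C s∉A (isCorner l)))
      (λ l j≢l → subst (λ P → Nonempty (∁ P ∩ φ u l)) (sym uj≡C)
        (corner-flippable clC (B1 u l) j≢l q∈A q∉C (corner-swap (isCorner l))))
      (subst₂ (λ P Q → Nonempty (∁ P ∩ ∁ Q)) (sym ui≡A) (sym uj≡C)
        (r , x∈p∩q⁺ (x∉p⇒x∈∁p r∉A , x∉p⇒x∈∁p r∉C)))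
    where
    isCorner : ∀ l → Corner A C (proj₁ (cornerPart A C l))
    isCorner l = proj₂ (proj₂ (cornerPart A C l))
    u : BunemanVertex 𝒮
    u = record
      { φ  = λ l → proj₁ (cornerPart A C l)
      ; B1 = λ l → proj₁ (proj₂ (cornerPart A C l))
      ; B2 = λ l m _ → corners-meet (p , x∈p∩q⁺ (p∈A , p∈C)) (isCorner l) (isCorner m)
      }
    i≢j : i ≢ j
    i≢j refl = q∉C (subst (q ∈_) (parts-overlap⇒≡ {S = split 𝒮 i} partA partC (p , x∈p∩q⁺ (p∈A , p∈C))) q∈A)
    ui≡A : φ u i ≡ A
    ui≡A = corner-at clA (B1 u i) p∈A p∈C (isCorner i)
    uj≡C : φ u j ≡ C
    uj≡C = corner-at clC (B1 u j) p∈C p∈A (corner-swap (isCorner j))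

  module _ (inj : RootedInjective r 𝒮) where

    -- At a split where the two medians differ, the majority parts are disjoint, so one of them
    -- omits `r` and is a cluster containing its own pair. If it contained the other pair too, the
    -- majority parts would meet and be equal.
    separating-cluster : ∀ {x y x′ y′} → x ≢ r → y ≢ r → x ≢ y → x′ ≢ r → y′ ≢ r → x′ ≢ y′ →
      ⁅ x ⁆ ∪ ⁅ y ⁆ ≢ ⁅ x′ ⁆ ∪ ⁅ y′ ⁆ →
      ∃₂ λ i A → IsCluster i A ×
        ((x ∈ A × y ∈ A × ¬ (x′ ∈ A × y′ ∈ A)) ⊎ (x′ ∈ A × y′ ∈ A × ¬ (x ∈ A × y ∈ A)))
    separating-cluster {x} {y} {x′} {y′} x≢r y≢r x≢y x′≢r y′≢r x′≢y′ Z≢Z′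
      with i , m≢m′ ← ¬∀⟶∃¬ _ _ (λ i → φ (majorityVertex 𝒮 x y r) i ≟ˢ φ (majorityVertex 𝒮 x′ y′ r) i)
                        (inj x y x′ y′ x≢r y≢r x≢y x′≢r y′≢r x′≢y′ Z≢Z′ _ _
                          (majorityVertex-isMedian 𝒮 x y r) (majorityVertex-isMedian 𝒮 x′ y′ r))
      with P , partP , majP ← majorityPart (split 𝒮 i) x y r
         | Q , partQ , majQ ← majorityPart (split 𝒮 i) x′ y′ r
      with r ∈? P
    ... | no r∉P =
      let x∈P , y∈P = majority-∌z majP r∉P in
      i , P , (partP , r∉P) , inj₁ (x∈P , y∈P , λ (x′∈P , y′∈P) →
        m≢m′ (parts-overlap⇒≡ {S = split 𝒮 i} partP partQ (majorities-meet (majority-xy x′∈P y′∈P) majQ)))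
    ... | yes r∈P =
      let r∉Q = λ r∈Q → m≢m′ (parts-overlap⇒≡ {S = split 𝒮 i} partP partQ (r , x∈p∩q⁺ (r∈P , r∈Q)))
          x′∈Q , y′∈Q = majority-∌z majQ r∉Q in
      i , Q , (partQ , r∉Q) , inj₂ (x′∈Q , y′∈Q , λ (x∈Q , y∈Q) →
        m≢m′ (parts-overlap⇒≡ {S = split 𝒮 i} partP partQ (majorities-meet majP (majority-xy x∈Q y∈Q))))

    Separates : Fin n → Fin n → Fin n → Set
    Separates x y z = ∃₂ λ i A → IsCluster i A × x ∈ A × y ∈ A × z ∉ A

    -- The pairs share `x`, so a cluster containing exactly one of them contains `x` and exactly one
    -- of `y`, `z`.
    separates-sharing : ∀ {x y z} → x ≢ r → y ≢ r → z ≢ r → x ≢ y → x ≢ z → y ≢ z →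
                        Separates x y z ⊎ Separates x z y
    separates-sharing {x} {y} {z} x≢r y≢r z≢r x≢y x≢z y≢z =
      classify (separating-cluster x≢r y≢r x≢y x≢r z≢r x≢z xy≢xz)
      where
      xy≢xz : ⁅ x ⁆ ∪ ⁅ y ⁆ ≢ ⁅ x ⁆ ∪ ⁅ z ⁆
      xy≢xz e with x∈p∪q⁻ ⁅ x ⁆ ⁅ z ⁆ (subst (y ∈_) e (x∈p∪q⁺ (inj₂ (x∈⁅x⁆ y))))
      ... | inj₁ y∈ = x≢y (sym (x∈⁅y⁆⇒x≡y x y∈))
      ... | inj₂ y∈ = y≢z (x∈⁅y⁆⇒x≡y z y∈)
      classify : _ → Separates x y z ⊎ Separates x z y
      classify (i , A , cl , inj₁ (x∈A , y∈A , ¬xz)) = inj₁ (i , A , cl , x∈A , y∈A , λ z∈A → ¬xz (x∈A , z∈A))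
      classify (i , A , cl , inj₂ (x∈A , z∈A , ¬xy)) = inj₂ (i , A , cl , x∈A , z∈A , λ y∈A → ¬xy (x∈A , y∈A))

    -- The pairs sharing `z` yield a second cluster, containing `z` and exactly one of `x`, `y`. The
    -- first contains `x` and `y` but not `z`, so the two cross in either case.
    separates⇒square : ∀ {x y z} → x ≢ r → y ≢ r → z ≢ r → x ≢ y → x ≢ z → y ≢ z →
                       Separates x y z → hypercube 2 ⊑ Buneman 𝒮
    separates⇒square x≢r y≢r z≢r x≢y x≢z y≢z (_ , _ , clA , x∈A , y∈A , z∉A) =
      [ (λ (_ , _ , clC , z∈C , x∈C , y∉C) → crossing⇒square clA clC x∈A y∈A z∉A x∈C z∈C y∉C)
      , (λ (_ , _ , clC , z∈C , y∈C , x∉C) → crossing⇒square clA clC y∈A x∈A z∉A y∈C z∈C x∉C)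
      ]′ (separates-sharing z≢r x≢r y≢r (≢-sym x≢z) (≢-sym y≢z) x≢y)

    triple⇒square : ∀ {x y z} → x ≢ r → y ≢ r → z ≢ r → x ≢ y → x ≢ z → y ≢ z → hypercube 2 ⊑ Buneman 𝒮
    triple⇒square x≢r y≢r z≢r x≢y x≢z y≢z =
      [ separates⇒square x≢r y≢r z≢r x≢y x≢z y≢z
      , separates⇒square x≢r z≢r y≢r x≢z x≢y (≢-sym y≢z)
      ]′ (separates-sharing x≢r y≢r z≢r x≢y x≢z y≢z)

-- `punchIn r` enumerates the elements other than `r`, and four elements leave a triple.
rootedInjective⇒square : 4 ≤ n → (𝒮 : SplitSystem n) (r : Fin n) → RootedInjective r 𝒮 → hypercube 2 ⊑ Buneman 𝒮
rootedInjective⇒square (s≤s (s≤s (s≤s (s≤s z≤n)))) 𝒮 r inj =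
  triple⇒square 𝒮 r inj (punchInᵢ≢i r zero) (punchInᵢ≢i r (suc zero)) (punchInᵢ≢i r (suc (suc zero)))
    ((λ ()) ∘ punchIn-injective r zero (suc zero))
    ((λ ()) ∘ punchIn-injective r zero (suc (suc zero)))
    ((λ ()) ∘ punchIn-injective r (suc zero) (suc (suc zero)))

-- From hypercubes to pairwise incompatible splits.

Incompatible : Split n → Split n → Set
Incompatible S T = ∀ {P Q} → P isPartOf S → Q isPartOf T → Nonempty (P ∩ Q)

incompatible-sym : {S T : Split n} → Incompatible S T → Incompatible T S
incompatible-sym inc {P} {Q} partP partQ = subst Nonempty (∩-comm Q P) (inc partQ partP)

-- `P` misses the complement of `Q`, which is also a part of `T`.
nested⇒¬incompatible : {S T : Split n} {P Q : Subset n} →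
  P isPartOf S → Q isPartOf T → P ⊆ Q → ¬ Incompatible S T
nested⇒¬incompatible {T = T} {P} {Q} partP partQ P⊆Q inc =
  let x , x∈ = inc partP (∁-isPart {S = T} partQ)
      x∈P , x∈∁Q = x∈p∩q⁻ P (∁ Q) x∈
  in x∈p⇒x∉∁p (P⊆Q x∈P) x∈∁Q

singleton⇒¬incompatible : {S T : Split n} {x : Fin n} → ⁅ x ⁆ isPartOf S → ¬ Incompatible S T
singleton⇒¬incompatible {S = S} {T} {x} part = nested⇒¬incompatible {S = S} {T} part (partContaining-isPart T x)
  λ y∈ → subst (_∈ partContaining T x) (sym (x∈⁅y⁆⇒x≡y x y∈)) (∈-partContaining T x)

module _ (𝒮 : SplitSystem n) where

  part-third : {u v w : BunemanVertex 𝒮} → ∀ {i} → φ u i ≢ φ v i → φ u i ≢ φ w i → φ v i ≡ φ w i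
  part-third {u} {v} {w} u≢v u≢w = trans (≢⇒∁ 𝒮 u v u≢v) (sym (≢⇒∁ 𝒮 u w u≢w))

  -- In a 4-cycle u, v, t, w opposite edges flip the same split, so all four combinations of
  -- parts of the two splits occur at its vertices.
  square⇒incompatible : {u v w t : BunemanVertex 𝒮} →
    ¬ (∀ i → φ v i ≡ φ w i) → ¬ (∀ i → φ u i ≡ φ t i) →
    ((a , _) : DifferOnce (φ u) (φ v)) ((b , _) : DifferOnce (φ u) (φ w)) →
    DifferOnce (φ v) (φ t) → DifferOnce (φ w) (φ t) →
    Incompatible (split 𝒮 a) (split 𝒮 b)
  square⇒incompatible {u} {v} {w} {t} v≉w u≉t
    (a , u≢v , uniq-uv) (b , u≢w , uniq-uw) (c , v≢t , uniq-vt) (e , w≢t , uniq-wt) {P} {Q} partP partQ =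
    combine partP-cases partQ-cases
    where
    same : ∀ {x y : BunemanVertex 𝒮} {a} → (∀ {j} → φ x j ≢ φ y j → a ≡ j) → ∀ j → a ≢ j → φ x j ≡ φ y j
    same uniq j a≢j = decidable-stable (_ ≟ˢ _) (a≢j ∘ uniq)
    -- If both edges at `u` flipped the same split, `v` and `w` would coincide.
    a≢b : a ≢ b
    a≢b refl = v≉w λ j → agree j
      where
      agree : ∀ j → φ v j ≡ φ w j
      agree j with a ≟ j
      ... | yes refl = part-third {u} {v} {w} u≢v u≢w
      ... | no a≢j   = trans (sym (same {u} {v} uniq-uv j a≢j)) (same {u} {w} uniq-uw j a≢j)
    va≢wa : φ v a ≢ φ w a
    va≢wa eq = u≢v (trans (same {u} {w} uniq-uw a (≢-sym a≢b)) (sym eq))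
    -- An edge from `v` to `t` flipping `a` again would undo the edge from `u` to `v` and lead back
    -- to `u`.
    va≡ta : φ v a ≡ φ t a
    va≡ta = decidable-stable (_ ≟ˢ _) λ va≢ta → u≉t (agree (uniq-vt va≢ta) va≢ta)
      where
      agree : c ≡ a → φ v a ≢ φ t a → ∀ j → φ u j ≡ φ t j
      agree refl va≢ta j with a ≟ j
      ... | yes refl = part-third {v} {u} {t} (≢-sym u≢v) va≢ta
      ... | no a≢j   = trans (same {u} {v} uniq-uv j a≢j) (same {v} {t} uniq-vt j a≢j)
    -- Now `w` and `t` differ at `a`, so this is the split flipped by the edge between them.
    e≡a : e ≡ a
    e≡a = uniq-wt λ wa≡ta → va≢wa (trans va≡ta (sym wa≡ta))
    wb≡tb : φ w b ≡ φ t b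
    wb≡tb = same {w} {t} uniq-wt b (a≢b ∘ trans (sym e≡a))
    partP-cases : P ≡ φ u a ⊎ P ≡ φ v a
    partP-cases with P ≟ˢ φ u a
    ... | yes eq = inj₁ eq
    ... | no ne  = inj₂ (trans (parts-≢⇒∁ {S = split 𝒮 a} (B1 u a) partP (≢-sym ne)) (sym (≢⇒∁ 𝒮 u v u≢v)))
    partQ-cases : Q ≡ φ u b ⊎ Q ≡ φ w b
    partQ-cases with Q ≟ˢ φ u b
    ... | yes eq = inj₁ eq
    ... | no ne  = inj₂ (trans (parts-≢⇒∁ {S = split 𝒮 b} (B1 u b) partQ (≢-sym ne)) (sym (≢⇒∁ 𝒮 u w u≢w)))
    at : ∀ {R R′} (x : BunemanVertex 𝒮) → R ≡ φ x a → R′ ≡ φ x b → Nonempty (R ∩ R′)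
    at x refl refl = B2 x a b a≢b
    combine : P ≡ φ u a ⊎ P ≡ φ v a → Q ≡ φ u b ⊎ Q ≡ φ w b → Nonempty (P ∩ Q)
    combine (inj₁ p) (inj₁ q) = at u p q
    combine (inj₁ p) (inj₂ q) = at w (trans p (same {u} {w} uniq-uw a (≢-sym a≢b))) q
    combine (inj₂ p) (inj₁ q) = at v p (trans q (same {u} {v} uniq-uv b a≢b))
    combine (inj₂ p) (inj₂ q) = at t (trans p va≡ta) (trans q wb≡tb)

  differOnce-≔ : (v : Vec Bool k) (i : Fin k) → lookup v i ≡ false →
                 DifferOnce (lookup v) (lookup (v [ i ]≔ true))
  differOnce-≔ v i vi≡false =
      i
    , (λ e → contradiction (trans (sym vi≡false) (trans e (lookup∘update i v true))) λ ())
    , λ {j} ne → decidable-stable (i ≟ j) λ i≢j → ne (sym (lookup∘update′ (≢-sym i≢j) v true))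

  -- The chosen splits are those flipped along the edges from the origin to the unit vectors. Two
  -- unit vectors, the origin and their sum form a 4-cycle.
  hypercube⇒incompatible : hypercube k ⊑ Buneman 𝒮 →
    Σ (Fin k → Fin (size 𝒮)) λ s → ∀ {i j} → i ≢ j → Incompatible (split 𝒮 (s i)) (split 𝒮 (s j))
  hypercube⇒incompatible {k} (f , adj) = (λ i → proj₁ (edge i)) , λ {i} {j} i≢j →
    square⇒incompatible {to origin} {to (unit i)} {to (unit j)} {to (unit i [ j ]≔ true)}
      (λ e → unit-≢ i≢j (injective e))
      (λ e → origin≢ i j (injective e))
      (edge i) (edge j)
      (adj (differOnce-≔ (unit i) j (off i≢j)))
      (subst (DifferOnce (φ (to (unit j))) ∘ φ ∘ to) ([]≔-commutes origin j i (≢-sym i≢j))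
        (adj (differOnce-≔ (unit j) i (off (≢-sym i≢j)))))
    where
    open Injection f using (to; injective)
    origin : Vec Bool k
    origin = Vec.replicate k false
    unit : Fin k → Vec Bool k
    unit i = origin [ i ]≔ true
    edge : ∀ i → DifferOnce (φ (to origin)) (φ (to (unit i)))
    edge i = adj (differOnce-≔ origin i (lookup-replicate i false))
    off : ∀ {i j} → i ≢ j → lookup (unit i) j ≡ false
    off {i} {j} i≢j = trans (lookup∘update′ (≢-sym i≢j) origin true) (lookup-replicate j false)
    unit-≢ : ∀ {i j} → i ≢ j → unit i ≢ unit j
    unit-≢ {i} {j} i≢j e = contradiction
      (trans (sym (lookup∘update i origin true)) (trans (cong (λ v → lookup v i) e) (off (≢-sym i≢j)))) λ ()
    origin≢ : ∀ i j → origin ≢ unit i [ j ]≔ true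
    origin≢ i j e = contradiction
      (trans (sym (lookup-replicate j false)) (trans (cong (λ v → lookup v j) e) (lookup∘update j (unit i) true))) λ ()

-- Split systems from lists of splits.

_≈ₛ?_ : (S T : Split n) → Dec (S ≈ₛ T)
S ≈ₛ? T = ((part₁ S ≟ˢ part₁ T) ×-dec (part₂ S ≟ˢ part₂ T))
    ⊎-dec ((part₁ S ≟ˢ part₂ T) ×-dec (part₂ S ≟ˢ part₁ T))

≈ₛ-sym : {S T : Split n} → S ≈ₛ T → T ≈ₛ S
≈ₛ-sym (inj₁ (p , q)) = inj₁ (sym p , sym q)
≈ₛ-sym (inj₂ (p , q)) = inj₂ (sym q , sym p)

isPart-resp-≈ : {S T : Split n} {P : Subset n} → S ≈ₛ T → P isPartOf S → P isPartOf T
isPart-resp-≈ (inj₁ (p , q)) (inj₁ e) = inj₁ (trans e p)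
isPart-resp-≈ (inj₁ (p , q)) (inj₂ e) = inj₂ (trans e q)
isPart-resp-≈ (inj₂ (p , q)) (inj₁ e) = inj₂ (trans e p)
isPart-resp-≈ (inj₂ (p , q)) (inj₂ e) = inj₁ (trans e q)

-- `AllPairs` compares an entry only with later ones; symmetry covers the opposite order.
allPairs-lookup-injective : {A : Set} {_~_ : A → A → Set} {xs : List A} → (∀ {x y} → x ~ y → y ~ x) →
  AllPairs (λ x y → ¬ x ~ y) xs → ∀ {i j} → List.lookup xs i ~ List.lookup xs j → i ≡ j
allPairs-lookup-injective sy (_  ∷ _)   {zero}  {zero}  _ = refl
allPairs-lookup-injective sy (≁s ∷ _)   {zero}  {suc j} e = contradiction e (All.lookup ≁s (∈-lookup j))
allPairs-lookup-injective sy (≁s ∷ _)   {suc i} {zero}  e = contradiction (sy e) (All.lookup ≁s (∈-lookup i))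
allPairs-lookup-injective sy (_  ∷ ≁ss) {suc i} {suc j} e = cong suc (allPairs-lookup-injective sy ≁ss e)

deduplicate-distinct : (L : List (Split n)) → AllPairs (λ S T → ¬ S ≈ₛ T) (deduplicate _≈ₛ?_ L)
deduplicate-distinct []      = []
deduplicate-distinct (S ∷ L) =
  all-filter (λ T → ¬? (S ≈ₛ? T)) (deduplicate _≈ₛ?_ L) ∷ AllPairs.filter⁺ _ (deduplicate-distinct L)

module _ (L : List (Split n)) where

  deduplicated-part : ∀ {P} → Any (P isPartOf_) L → ∃ λ i → P isPartOf List.lookup (deduplicate _≈ₛ?_ L) i
  deduplicated-part {P} any = Any.index any′ , Any.lookup-index any′
    where
    any′ : Any (P isPartOf_) (deduplicate _≈ₛ?_ L)
    any′ = Any.deduplicate⁺ _≈ₛ?_ (λ {S} {T} T≈S → isPart-resp-≈ {S = S} {T} (≈ₛ-sym {S = T} {S} T≈S)) any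

  -- Duplicates are removed because the list used below has repetitions: the ray at the least
  -- element other than `r`, for instance, is a singleton.
  fromList : (∀ x → Any (⁅ x ⁆ isPartOf_) L) → SplitSystem n
  fromList triv = record
    { split    = List.lookup (deduplicate _≈ₛ?_ L)
    ; distinct = allPairs-lookup-injective (λ {S} {T} → ≈ₛ-sym {S = S} {T}) (deduplicate-distinct L)
    ; trivial  = deduplicated-part ∘ triv
    }

-- Rays of a total order that avoid the root.

complementSplit : (A : Subset n) → Nonempty A → Nonempty (∁ A) → Split n
complementSplit A ne ne′ = record
  { part₁     = A
  ; part₂     = ∁ A
  ; nonempty₁ = ne
  ; nonempty₂ = ne′
  ; disjoint  = λ (x , x∈) → let x∈A , x∈∁A = x∈p∩q⁻ A (∁ A) x∈ in x∈p⇒x∉∁p x∈A x∈∁A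
  ; cover     = p∪∁p≡⊤ A
  }

module _ {P : Fin n → Set} (P? : ∀ x → Dec (P x)) where

  comprehension : Subset n
  comprehension = Vec.tabulate (does ∘ P?)

  ∈-comprehension⁺ : ∀ {x} → P x → x ∈ comprehension
  ∈-comprehension⁺ {x} px = lookup⇒[]= x comprehension (trans (lookup∘tabulate (does ∘ P?) x) (dec-true (P? x) px))

  ∈-comprehension⁻ : ∀ {x} → x ∈ comprehension → P x
  ∈-comprehension⁻ {x} x∈ = decidable-stable (P? x) λ ¬px → contradiction
    (trans (sym ([]=⇒lookup x∈)) (trans (lookup∘tabulate (does ∘ P?) x) (dec-false (P? x) ¬px))) λ ()

-- The order is a parameter so that the usual order and its reverse provide both chains of clusters.
module Ray (r : Fin n) {_≼_ : Fin n → Fin n → Set} (O : IsDecTotalOrder _≡_ _≼_) where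
  private module O = IsDecTotalOrder O

  inRay? : ∀ b y → Dec (y ≢ r × y ≼ b)
  inRay? b y = ¬? (y ≟ r) ×-dec (y O.≤? b)

  ray : Fin n → Subset n
  ray b = comprehension (inRay? b)

  ∈-ray⁺ : ∀ {b y} → y ≢ r → y ≼ b → y ∈ ray b
  ∈-ray⁺ {b} y≢r y≼b = ∈-comprehension⁺ (inRay? b) (y≢r , y≼b)

  ∈-ray⁻ : ∀ {b y} → y ∈ ray b → y ≢ r × y ≼ b
  ∈-ray⁻ {b} = ∈-comprehension⁻ (inRay? b)

  r∉ray : ∀ {b} → r ∉ ray b
  r∉ray {b} r∈ = proj₁ (∈-ray⁻ {b} r∈) refl

  raySplit : ∀ b → b ≢ r → Split n
  raySplit b b≢r = complementSplit (ray b) (b , ∈-ray⁺ b≢r O.refl) (r , x∉p⇒x∈∁p (r∉ray {b}))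

  ray-mono : ∀ {b c} → b ≼ c → ray b ⊆ ray c
  ray-mono {b} b≼c y∈ = let y≢r , y≼b = ∈-ray⁻ {b} y∈ in ∈-ray⁺ y≢r (O.trans y≼b b≼c)

  rays⇒¬incompatible : (S T : Split n) → ∀ {b c} → ray b isPartOf S → ray c isPartOf T → ¬ Incompatible S T
  rays⇒¬incompatible S T {b} {c} partS partT inc with O.total b c
  ... | inj₁ b≼c = nested⇒¬incompatible {S = S} {T} partS partT (ray-mono b≼c) inc
  ... | inj₂ c≼b = nested⇒¬incompatible {S = T} {S} partT partS (ray-mono c≼b) (incompatible-sym {S = S} {T} inc)

  -- For pairs avoiding `r`: every ray containing the first pair contains the second.
  BoundsTransfer : Fin n → Fin n → Fin n → Fin n → Set
  BoundsTransfer x y x′ y′ = ∀ b → b ≢ r → x ≼ b → y ≼ b → x′ ≼ b × y′ ≼ b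

  transfer-swap : ∀ {x y x′ y′} → BoundsTransfer x y x′ y′ → BoundsTransfer y x x′ y′
  transfer-swap H b b≢r y≼b x≼b = H b b≢r x≼b y≼b

  transfer-swap′ : ∀ {x y x′ y′} → BoundsTransfer x y x′ y′ → BoundsTransfer x y y′ x′
  transfer-swap′ H b b≢r x≼b y≼b = Product.swap (H b b≢r x≼b y≼b)

  -- Each maximum differs from `r` and is thus an admissible bound of its own pair, hence of the
  -- other pair.
  maximum-unique : ∀ {x y x′ y′} → y ≢ r → y′ ≢ r → x ≼ y → x′ ≼ y′ →
                   BoundsTransfer x y x′ y′ → BoundsTransfer x′ y′ x y → y ≡ y′
  maximum-unique y≢r y′≢r x≼y x′≼y′ H H′ = O.antisym
    (proj₂ (H′ _ y′≢r x′≼y′ O.refl)) (proj₂ (H _ y≢r x≼y O.refl))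

  -- A ray containing `x` and `y` is the value of `m` at its split, hence also that of `m′`. Since
  -- it omits `r`, the majority puts both `x′` and `y′` into it.
  majorities-transfer : (𝒮 : SplitSystem n) → (∀ b → b ≢ r → ∃ λ i → ray b isPartOf split 𝒮 i) →
    ∀ {x y x′ y′} → x ≢ r → y ≢ r → (m m′ : BunemanVertex 𝒮) →
    (∀ i → Majority x y r (φ m i)) → (∀ i → Majority x′ y′ r (φ m′ i)) → (∀ i → φ m i ≡ φ m′ i) →
    BoundsTransfer x y x′ y′
  majorities-transfer 𝒮 rays x≢r y≢r m m′ maj maj′ m≗m′ b b≢r x≼b y≼b =
    let i , part = rays b b≢r
        m≡ray    = parts-overlap⇒≡ {S = split 𝒮 i} (B1 m i) part
                     (majorities-meet (maj i) (majority-xy (∈-ray⁺ x≢r x≼b) (∈-ray⁺ y≢r y≼b)))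
        maj-ray  = subst (Majority _ _ r) (trans (sym (m≗m′ i)) m≡ray) (maj′ i)
        x′∈ , y′∈ = majority-∌z maj-ray (r∉ray {b})
    in proj₂ (∈-ray⁻ {b} x′∈) , proj₂ (∈-ray⁻ {b} y′∈)

-- The split system formed by the two chains of rays.

module TwoRays (r : Fin (suc (suc k))) where

  module Up   = Ray r ≤-isDecTotalOrder
  module Down = Ray r (Flip.isDecTotalOrder ≤-isDecTotalOrder)

  singletonSplit : Fin (suc (suc k)) → Split (suc (suc k))
  singletonSplit x = complementSplit ⁅ x ⁆ (x , x∈⁅x⁆ x) (y , x∉p⇒x∈∁p λ y∈ → punchInᵢ≢i x zero (x∈⁅y⁆⇒x≡y x y∈))
    -- Some element other than `x`, showing that the complement of the singleton is nonempty.
    where y = punchIn x zero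

  upSplit downSplit : Fin (suc k) → Split (suc (suc k))
  upSplit   j = Up.raySplit (punchIn r j) (punchInᵢ≢i r j)
  downSplit j = Down.raySplit (punchIn r j) (punchInᵢ≢i r j)

  singletons ups downs splits : List (Split (suc (suc k)))
  singletons = List.tabulate singletonSplit
  ups        = List.tabulate upSplit
  downs      = List.tabulate downSplit
  splits     = singletons ++ ups ++ downs

  system : SplitSystem (suc (suc k))
  system = fromList splits λ x → Any.++⁺ˡ (Any.tabulate⁺ {f = singletonSplit} x (inj₁ refl))

  up-in-system : ∀ b → b ≢ r → ∃ λ i → Up.ray b isPartOf split system i
  up-in-system b b≢r = deduplicated-part splits (Any.++⁺ʳ singletons (Any.++⁺ˡ {ys = downs}
    (Any.tabulate⁺ {f = upSplit} (punchOut (≢-sym b≢r))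
      (inj₁ (cong Up.ray (sym (punchIn-punchOut (≢-sym b≢r))))))))

  down-in-system : ∀ b → b ≢ r → ∃ λ i → Down.ray b isPartOf split system i
  down-in-system b b≢r = deduplicated-part splits (Any.++⁺ʳ singletons (Any.++⁺ʳ ups
    (Any.tabulate⁺ {f = downSplit} (punchOut (≢-sym b≢r))
      (inj₁ (cong Down.ray (sym (punchIn-punchOut (≢-sym b≢r))))))))

  -- Records the origin of a split, which its index after deduplication no longer shows. The kinds
  -- may overlap.
  data Kind (S : Split (suc (suc k))) : Set where
    singleton : ∀ x → ⁅ x ⁆ isPartOf S → Kind S
    up        : ∀ b → Up.ray b isPartOf S → Kind S
    down      : ∀ b → Down.ray b isPartOf S → Kind S

  kind : ∀ i → Kind (split system i)
  kind i with ∈-++⁻ singletons (∈-deduplicate⁻ _≈ₛ?_ splits (∈-lookup i))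
  ... | inj₁ S∈ = let x , e = ∈-tabulate⁻ {f = singletonSplit} S∈ in
                    singleton x (subst (⁅ x ⁆ isPartOf_) (sym e) (inj₁ refl))
  ... | inj₂ S∈ with ∈-++⁻ ups S∈
  ...   | inj₁ S∈′ = let j , e = ∈-tabulate⁻ {f = upSplit} S∈′ in
                     up (punchIn r j) (subst (Up.ray (punchIn r j) isPartOf_) (sym e) (inj₁ refl))
  ...   | inj₂ S∈′ = let j , e = ∈-tabulate⁻ {f = downSplit} S∈′ in
                     down (punchIn r j) (subst (Down.ray (punchIn r j) isPartOf_) (sym e) (inj₁ refl))

  -- A trivial split is incompatible with no split, and among three rays two have the same direction
  -- and are nested.
  no-three-incompatible : {S T U : Split (suc (suc k))} → Kind S → Kind T → Kind U →
    Incompatible S T → Incompatible S U → ¬ Incompatible T U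
  no-three-incompatible {S} {T} (singleton x p) _ _ st _  _  =
    singleton⇒¬incompatible {S = S} {T} p st
  no-three-incompatible {S} {T} _ (singleton x p) _ st _  _  =
    singleton⇒¬incompatible {S = T} {S} p (incompatible-sym {S = S} {T} st)
  no-three-incompatible {S} {T} {U} _ _ (singleton x p) _  su _  =
    singleton⇒¬incompatible {S = U} {S} p (incompatible-sym {S = S} {U} su)
  no-three-incompatible {S} {T} {U} (up b p)   (up c q)   _          st _  _  =
    Up.rays⇒¬incompatible S T {b} {c} p q st
  no-three-incompatible {S} {T} {U} (up b p)   (down c q) (up d s)   _  su _  =
    Up.rays⇒¬incompatible S U {b} {d} p s su
  no-three-incompatible {S} {T} {U} (up b p)   (down c q) (down d s) _  _  tu =
    Down.rays⇒¬incompatible T U {c} {d} q s tu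
  no-three-incompatible {S} {T} {U} (down b p) (down c q) _          st _  _  =
    Down.rays⇒¬incompatible S T {b} {c} p q st
  no-three-incompatible {S} {T} {U} (down b p) (up c q)   (down d s) _  su _  =
    Down.rays⇒¬incompatible S U {b} {d} p s su
  no-three-incompatible {S} {T} {U} (down b p) (up c q)   (up d s)   _  _  tu =
    Up.rays⇒¬incompatible T U {c} {d} q s tu

  dim≤2 : ∀ l → hypercube l ⊑ Buneman system → l ≤ 2
  dim≤2 0 _ = z≤n
  dim≤2 1 _ = s≤s z≤n
  dim≤2 2 _ = ≤-refl
  dim≤2 (suc (suc (suc l))) embedding =
    let s , inc = hypercube⇒incompatible system embedding
        i = s zero
        j = s (suc zero)
        h = s (suc (suc zero))
    in ⊥-elim (no-three-incompatible {split system i} {split system j} {split system h} (kind i) (kind j) (kind h)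
                 (inc λ ()) (inc λ ()) (inc λ ()))

  -- The upward bounds fix the larger element and the downward bounds the smaller one, a minimum
  -- being a maximum of the reversed order. The swaps bring the extremal element into second place.
  pair-determined : ∀ {x y x′ y′} → x ≢ r → y ≢ r → x′ ≢ r → y′ ≢ r →
    Up.BoundsTransfer x y x′ y′ → Up.BoundsTransfer x′ y′ x y →
    Down.BoundsTransfer x y x′ y′ → Down.BoundsTransfer x′ y′ x y →
    ⁅ x ⁆ ∪ ⁅ y ⁆ ≡ ⁅ x′ ⁆ ∪ ⁅ y′ ⁆
  pair-determined {x} {y} {x′} {y′} x≢r y≢r x′≢r y′≢r U U′ D D′ with ≤-total x y | ≤-total x′ y′
  ... | inj₁ x≤y | inj₁ x′≤y′ = cong₂ (λ a b → ⁅ a ⁆ ∪ ⁅ b ⁆)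
    (Down.maximum-unique x≢r x′≢r x≤y x′≤y′
      (Down.transfer-swap (Down.transfer-swap′ D)) (Down.transfer-swap (Down.transfer-swap′ D′)))
    (Up.maximum-unique y≢r y′≢r x≤y x′≤y′ U U′)
  ... | inj₁ x≤y | inj₂ y′≤x′ = trans (cong₂ (λ a b → ⁅ a ⁆ ∪ ⁅ b ⁆)
    (Down.maximum-unique x≢r y′≢r x≤y y′≤x′ (Down.transfer-swap D) (Down.transfer-swap′ D′))
    (Up.maximum-unique y≢r x′≢r x≤y y′≤x′ (Up.transfer-swap′ U) (Up.transfer-swap U′))) (∪-comm ⁅ y′ ⁆ ⁅ x′ ⁆)
  ... | inj₂ y≤x | inj₁ x′≤y′ = trans (cong₂ (λ a b → ⁅ a ⁆ ∪ ⁅ b ⁆)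
    (Up.maximum-unique x≢r y′≢r y≤x x′≤y′ (Up.transfer-swap U) (Up.transfer-swap′ U′))
    (Down.maximum-unique y≢r x′≢r y≤x x′≤y′ (Down.transfer-swap′ D) (Down.transfer-swap D′))) (∪-comm ⁅ y′ ⁆ ⁅ x′ ⁆)
  ... | inj₂ y≤x | inj₂ y′≤x′ = cong₂ (λ a b → ⁅ a ⁆ ∪ ⁅ b ⁆)
    (Up.maximum-unique x≢r x′≢r y≤x y′≤x′
      (Up.transfer-swap (Up.transfer-swap′ U)) (Up.transfer-swap (Up.transfer-swap′ U′)))
    (Down.maximum-unique y≢r y′≢r y≤x y′≤x′ D D′)

  system-rootedInjective : RootedInjective r system
  system-rootedInjective x y x′ y′ x≢r y≢r _ x′≢r y′≢r _ Z≢Z′ m m′ med med′ m≈m′ =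
    Z≢Z′ (pair-determined x≢r y≢r x′≢r y′≢r
      (Up.majorities-transfer system up-in-system x≢r y≢r m m′ maj maj′ m≈m′)
      (Up.majorities-transfer system up-in-system x′≢r y′≢r m′ m maj′ maj (sym ∘ m≈m′))
      (Down.majorities-transfer system down-in-system x≢r y≢r m m′ maj maj′ m≈m′)
      (Down.majorities-transfer system down-in-system x′≢r y′≢r m′ m maj′ maj (sym ∘ m≈m′)))
    where
    maj : ∀ i → Majority x y r (φ m i)
    maj = median⇒majority system {m = m} med
    maj′ : ∀ i → Majority x′ y′ r (φ m′ i)
    maj′ = median⇒majority system {m = m′} med′

theorem5 : (n : ℕ) → 4 ≤ n → (r : Fin n) →
    (∃ λ (𝒮 : SplitSystem n) → RootedInjective r 𝒮 × HasDim 𝒮 2)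
    × IsID n r 2
theorem5 (suc zero) (s≤s ()) r
theorem5 (suc (suc n)) 4≤n r =
  -- For minimality, `maximal` bounds the dimension of every embedded cube by `d`, and a square
  -- embeds.
  witness , witness , λ 𝒮 d inj (_ , maximal) → maximal 2 (rootedInjective⇒square 4≤n 𝒮 r inj)
  where
  open TwoRays r
  witness : ∃ λ (𝒮 : SplitSystem (suc (suc n))) → RootedInjective r 𝒮 × HasDim 𝒮 2
  witness = system , system-rootedInjective , rootedInjective⇒square 4≤n system r system-rootedInjective , dim≤2
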